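{- Let $k\ge 2$. For every symmetric function $f:\{0,1\}^k\to\mathbb R_{\ge 0}$ which is not constant, $f$ supports at least one of pinning-to-$0$, pinning-to-$1$ and $2$-equality.
   Context: A $k$-uniform hypergraph $H=(V,\mathcal F)$ consists of a finite vertex set $V$ and a set $\mathcal F$ of $k$-element subsets of $V$ (hyperedges). For a symmetric $f:\{0,1\}^k\to\mathbb R_{\ge0}$ and $\sigma:V\to\{0,1\}$ let $w_{f;H}(\sigma)=\prod_{\{v_1,\dots,v_k\}\in\mathcal F}f(\sigma(v_1),\dots,\sigma(v_k))$ and $Z_{f;H}=\sum_\sigma w_{f;H}(\sigma)$. When $Z_{f;H}>0$, $\mu_{f;H}$ is the probability distribution on configurations $\sigma:V\to\{0,1\}$ with $\mu_{f;H}(\sigma)=w_{f;H}(\sigma)/Z_{f;H}$; statements about $\mu_{f;H}$ implicitly require $Z_{f;H}>0$. Write $\sigma_v=\sigma(v)$. For $s\in\{0,1\}$, $f$ supports pinning-to-$s$ if for every $\varepsilon>0$ there is a ($k$-uniform, finite) hypergraph $H$ with a vertex $v$ such that $\mu_{f;H}(\sigma_v=s)\ge 1-\varepsilon$. For an integer $t\ge2$, $f$ supports $t$-equality if for every $\varepsilon>0$ there is a ($k$-uniform, finite) hypergraph $H$ with distinct vertices $v_1,\dots,v_t$ such that for each $s\in\{0,1\}$, $\mu_{f;H}(\sigma_{v_1}=\dots=\sigma_{v_t}=s)\ge(1-\varepsilon)/2$. -}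

module Defs where

open import Algebra.Bundles using (CommutativeRing)
open import Data.Bool using (Bool; true; false; if_then_else_)
open import Data.Bool.Properties using (_≟_)
open import Data.Fin using (Fin)
open import Data.Fin.Permutation using (Permutation′; _⟨$⟩ʳ_)
open import Data.Fin.Properties using (all?)
open import Data.Fin.Subset using (Subset; inside; outside; ∣_∣)
open import Data.List using (List; foldr; map)
open import Data.List.Relation.Unary.Unique.Propositional using (Unique)
open import Data.Nat using (ℕ; zero; suc)
open import Data.Product using (Σ; ∃; _×_; _,_; proj₁; proj₂)
open import Data.Vec using (Vec; []; _∷_; lookup; tabulate; cast)
open import Function.Definitions using (Injective)
open import Level using (0ℓ)
open import Relation.Binary.Core using (Rel)
open import Relation.Binary.PropositionalEquality using (_≡_)
open import Relation.Binary.Structures using (IsStrictTotalOrder)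
import Relation.Binary.Construct.StrictToNonStrict as StrictToNonStrict
open import Relation.Nullary using (¬_; does)
open import Relation.Unary using (Pred; Decidable; Satisfiable)

-- ℝ as in classical mathematics: a Dedekind-complete totally ordered field,
-- which is unique up to isomorphism.
record Reals : Set₁ where
  infix 4 _<_
  field
    commutativeRing : CommutativeRing 0ℓ 0ℓ
  open CommutativeRing commutativeRing public
  field
    _<_                : Rel Carrier 0ℓ
    isStrictTotalOrder : IsStrictTotalOrder _≈_ _<_
    0<1                : 0# < 1#
    +-monoˡ-<          : ∀ {x y} z → x < y → x + z < y + z
    *-pos              : ∀ {x y} → 0# < x → 0# < y → 0# < x * y
    inverse            : ∀ {x} → ¬ x ≈ 0# → ∃ λ y → x * y ≈ 1#

  open StrictToNonStrict _≈_ _<_ public using (_≤_)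

  _IsUpperBoundOf_ : Carrier → Pred Carrier 0ℓ → Set
  b IsUpperBoundOf S = ∀ {x} → S x → x ≤ b

  -- Leastness is stated positively: nothing below s bounds S, because
  -- some element of S exceeds it.
  _IsSupremumOf_ : Carrier → Pred Carrier 0ℓ → Set
  s IsSupremumOf S =
    s IsUpperBoundOf S × (∀ {y} → y < s → ∃ λ x → S x × y < x)

  field
    complete : ∀ (S : Pred Carrier 0ℓ) → Satisfiable S →
               ∃ (_IsUpperBoundOf S) → ∃ (_IsSupremumOf S)

  module Order = IsStrictTotalOrder isStrictTotalOrder

  _/_[_] : Carrier → (y : Carrier) → 0# < y → Carrier
  x / y [ y>0 ] =
    x * proj₁ (inverse (λ y≈0 → Order.irrefl (sym y≈0) y>0))

  2# : Carrier
  2# = 1# + 1#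

  0<2 : 0# < 2#
  0<2 = Order.trans 0<1
          (Order.<-respˡ-≈ (+-identityˡ 1#) (+-monoˡ-< 1# 0<1))

record Hypergraph (k n : ℕ) : Set where
  field
    hyperedges : List (Σ (Subset n) λ e → ∣ e ∣ ≡ k)
    distinct   : Unique (map proj₁ hyperedges)

-- σ : V → {0,1} for V = Fin n, with false as 0 and true as 1.
Configuration : ℕ → Set
Configuration n = Vec Bool n

-- (σ(v₁), …, σ(vₘ)) for e = {v₁ < … < vₘ}.
restrict : ∀ {n} (e : Subset n) → Configuration n → Vec Bool ∣ e ∣
restrict []            []      = []
restrict (inside  ∷ e) (s ∷ σ) = s ∷ restrict e σ
restrict (outside ∷ e) (s ∷ σ) = restrict e σ

module Spin (ℝ : Reals) where
  open Reals ℝ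

  -- Σ over all σ : {0,1}ⁿ.
  sumConfigurations : ∀ n → (Configuration n → Carrier) → Carrier
  sumConfigurations zero    g = g []
  sumConfigurations (suc n) g =
    sumConfigurations n (λ σ → g (false ∷ σ)) +
    sumConfigurations n (λ σ → g (true ∷ σ))

  module _ {k : ℕ} (f : Vec Bool k → Carrier) where

    NonNegative : Set
    NonNegative = ∀ x → 0# ≤ f x

    Symmetric : Set
    Symmetric = ∀ (π : Permutation′ k) x →
                f (tabulate (λ i → lookup x (π ⟨$⟩ʳ i))) ≈ f x

    Constant : Set
    Constant = ∃ λ c → ∀ x → f x ≈ c

    module _ {n : ℕ} (H : Hypergraph k n) where
      open Hypergraph H

      weight : Configuration n → Carrier
      weight σ =
        foldr (λ (e , ∣e∣≡k) w → f (cast ∣e∣≡k (restrict e σ)) * w) 1# hyperedges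

      Z : Carrier
      Z = sumConfigurations n weight

      μ : 0# < Z → Configuration n → Carrier
      μ Z>0 σ = weight σ / Z [ Z>0 ]

      probability : 0# < Z → {A : Pred (Configuration n) 0ℓ} →
                    Decidable A → Carrier
      probability Z>0 A? =
        sumConfigurations n (λ σ → if does (A? σ) then μ Z>0 σ else 0#)

    SupportsPinning : Bool → Set
    SupportsPinning s =
      ∀ ε → 0# < ε →
      Σ ℕ λ n → Σ (Hypergraph k n) λ H → Σ (Fin n) λ v → Σ (0# < Z H) λ Z>0 →
      1# - ε ≤ probability H Z>0 (λ σ → lookup σ v ≟ s)

    SupportsEquality : ℕ → Set
    SupportsEquality t =
      ∀ ε → 0# < ε →
      Σ ℕ λ n → Σ (Hypergraph k n) λ H → Σ (Fin t → Fin n) λ v →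
      Injective _≡_ _≡_ v ×
      Σ (0# < Z H) λ Z>0 → ∀ s →
      (1# - ε) / 2# [ 0<2 ] ≤
        probability H Z>0 (λ σ → all? (λ i → lookup σ (v i) ≟ s))

{-# OPTIONS --safe #-}

-- Two terminals u, v and m disjoint blocks of k - 1 further vertices, with the
-- edges block ∪ {u} and block ∪ {v} for every block, give
-- Z(σ_u = a, σ_v = b) = T(a,b)^m where T(a,b) = Σ_x f(a,x) f(b,x).  Put
-- A = T(0,0), B = T(1,1), C = T(0,1).  Then A + B - 2C = Σ_x (f(0,x) - f(1,x))²,
-- which is positive: otherwise, f being symmetric, changing any one argument
-- would not change its value, and f would be constant.  Hence C < max(A,B), and
-- as m grows A^m, B^m or both together dominate: if A > B then u is pinned to 0,
-- if A < B it is pinned to 1, and if A = B then u and v become equal.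

module Submission where

open import Data.Bool using (Bool; true; false)
open import Data.Nat using (ℕ) renaming (_≤_ to _≤ℕ_)
open import Data.Sum using (_⊎_)
open import Data.Vec using (Vec)
open import Relation.Nullary using (¬_)
open import Defs

open import Data.Bool using (not)
open import Data.Bool.Properties using (_≟_)
open import Data.Empty using (⊥-elim)
open import Data.Fin using (zero; suc; _↑ˡ_)
open import Data.Fin.Permutation using (Permutation′; _⟨$⟩ʳ_; transpose)
open import Data.Fin.Properties using (all?; ↑ˡ-injective)
open import Data.Fin.Subset using (Subset; inside; outside; ∣_∣; ⊤; ⊥)
open import Data.Fin.Subset.Properties using (∣⊥∣≡0)
open import Data.List using (List; []; _∷_; foldr; map) renaming (_++_ to _++ₗ_)
open import Data.List.Membership.Propositional.Properties using (∈-map⁻)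
open import Data.List.Properties using (map-∘; map-++)
open import Data.List.Relation.Binary.Disjoint.Propositional using (Disjoint)
import Data.List.Relation.Unary.All as All using (universal)
import Data.List.Relation.Unary.All.Properties as All using (map⁺)
open import Data.List.Relation.Unary.AllPairs using ([]; _∷_)
open import Data.List.Relation.Unary.Unique.Propositional using (Unique)
import Data.List.Relation.Unary.Unique.Propositional.Properties as Unique
open import Data.Nat using (zero; suc; pred; s≤s) renaming (_+_ to _+ℕ_; _*_ to _*ℕ_)
open import Data.Product using (Σ; ∃; _×_; _,_; proj₁; proj₂)
open import Data.Sum using (inj₁; inj₂)
open import Data.Vec using ([]; _∷_; _++_; _[_]≔_; cast; lookup; replicate; tabulate)
open import Data.Vec.Properties using (++-injectiveʳ; lookup∘updateAt′; tabulate-cong)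
open import Function using (case_of_)
open import Function.Bundles using (Injection)
open import Function.Properties.Inverse using (↔⇒↣)
open import Relation.Binary.Bundles using (StrictTotalOrder)
open import Relation.Binary.Definitions using (tri<; tri≈; tri>)
open import Relation.Binary.PropositionalEquality as ≡ using (_≡_; _≢_; cong; cong₂; subst)
import Algebra.Properties.CommutativeSemiring.Exp
import Algebra.Properties.Ring
import Algebra.Solver.Ring.NaturalCoefficients.Default
import Relation.Binary.Construct.StrictToNonStrict
import Relation.Binary.Reasoning.StrictPartialOrder

-- Ordered-field inequalities and the decay of powers.

module OrderedField (ℝ : Reals) where
  open Reals ℝ
  open Algebra.Properties.CommutativeSemiring.Exp commutativeSemiring public
    using (_^_; ^-distrib-*; ^-congˡ)
  open Algebra.Properties.Ring ring public using (-‿involutive; -0#≈0#)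
  open Algebra.Solver.Ring.NaturalCoefficients.Default commutativeSemiring public
    using (solve; _:=_; _:+_; _:*_; con)

  private
    module NonStrict = Relation.Binary.Construct.StrictToNonStrict _≈_ _<_

  strictTotalOrder : StrictTotalOrder _ _ _
  strictTotalOrder = record { isStrictTotalOrder = isStrictTotalOrder }

  module ≤-Reasoning = Relation.Binary.Reasoning.StrictPartialOrder
    (StrictTotalOrder.strictPartialOrder strictTotalOrder)
  open ≤-Reasoning

  ≤-refl : ∀ {x} → x ≤ x
  ≤-refl = inj₂ refl

  ≤-trans : ∀ {x y z} → x ≤ y → y ≤ z → x ≤ z
  ≤-trans = NonStrict.trans isEquivalence Order.<-resp-≈ Order.trans

  ≤⇒≯ : ∀ {x y} → x ≤ y → ¬ y < x
  ≤⇒≯ {x} {y} x≤y y<x = Order.irrefl refl (begin-strict x ≤⟨ x≤y ⟩ y <⟨ y<x ⟩ x ∎)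

  ≮⇒≥ : ∀ {x y} → ¬ x < y → y ≤ x
  ≮⇒≥ {x} {y} x≮y with Order.compare x y
  ... | tri< x<y _ _ = ⊥-elim (x≮y x<y)
  ... | tri≈ _ x≈y _ = inj₂ (sym x≈y)
  ... | tri> _ _ y<x = inj₁ y<x

  ≤-total : ∀ x y → x ≤ y ⊎ y ≤ x
  ≤-total = NonStrict.total Order.compare

  +-monoˡ-≤ : ∀ {x y} z → x ≤ y → x + z ≤ y + z
  +-monoˡ-≤ z (inj₁ x<y) = inj₁ (+-monoˡ-< z x<y)
  +-monoˡ-≤ z (inj₂ x≈y) = inj₂ (+-congʳ x≈y)

  +-monoʳ-< : ∀ {x y} z → x < y → z + x < z + y
  +-monoʳ-< {x} {y} z x<y = begin-strict
    z + x ≈⟨ +-comm z x ⟩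
    x + z <⟨ +-monoˡ-< z x<y ⟩
    y + z ≈⟨ +-comm y z ⟩
    z + y ∎

  +-monoʳ-≤ : ∀ {x y} z → x ≤ y → z + x ≤ z + y
  +-monoʳ-≤ z (inj₁ x<y) = inj₁ (+-monoʳ-< z x<y)
  +-monoʳ-≤ z (inj₂ x≈y) = inj₂ (+-congˡ x≈y)

  +-mono-≤ : ∀ {x y u v} → x ≤ y → u ≤ v → x + u ≤ y + v
  +-mono-≤ {x} {y} {u} {v} x≤y u≤v = ≤-trans (+-monoˡ-≤ u x≤y) (+-monoʳ-≤ y u≤v)

  +-mono-<-≤ : ∀ {x y u v} → x < y → u ≤ v → x + u < y + v
  +-mono-<-≤ {x} {y} {u} {v} x<y u≤v = begin-strict
    x + u <⟨ +-monoˡ-< u x<y ⟩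
    y + u ≤⟨ +-monoʳ-≤ y u≤v ⟩
    y + v ∎

  +-mono-≤-< : ∀ {x y u v} → x ≤ y → u < v → x + u < y + v
  +-mono-≤-< {x} {y} {u} {v} x≤y u<v = begin-strict
    x + u ≤⟨ +-monoˡ-≤ u x≤y ⟩
    y + u <⟨ +-monoʳ-< y u<v ⟩
    y + v ∎

  +-nonneg : ∀ {x y} → 0# ≤ x → 0# ≤ y → 0# ≤ x + y
  +-nonneg {x} {y} 0≤x 0≤y = begin
    0#      ≈⟨ +-identityʳ 0# ⟨
    0# + 0# ≤⟨ +-mono-≤ 0≤x 0≤y ⟩
    x + y   ∎

  x≤x+y : ∀ {x y} → 0# ≤ y → x ≤ x + y
  x≤x+y {x} {y} 0≤y = begin
    x      ≈⟨ +-identityʳ x ⟨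
    x + 0# ≤⟨ +-monoʳ-≤ x 0≤y ⟩
    x + y  ∎

  x<x+y : ∀ {x y} → 0# < y → x < x + y
  x<x+y {x} {y} 0<y = begin-strict
    x      ≈⟨ +-identityʳ x ⟨
    x + 0# <⟨ +-monoʳ-< x 0<y ⟩
    x + y  ∎

  x-y+y≈x : ∀ x y → (x - y) + y ≈ x
  x-y+y≈x x y = begin-equality
    (x - y) + y     ≈⟨ +-assoc x (- y) y ⟩
    x + (- y + y)   ≈⟨ +-congˡ (-‿inverseˡ y) ⟩
    x + 0#          ≈⟨ +-identityʳ x ⟩
    x               ∎

  x+x≈2x : ∀ x → x + x ≈ 2# * x
  x+x≈2x x = begin-equality
    x + x           ≈⟨ +-cong (*-identityˡ x) (*-identityˡ x) ⟨
    1# * x + 1# * x ≈⟨ distribʳ x 1# 1# ⟨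
    2# * x          ∎

  +-cancelʳ-≤ : ∀ {x y} z → x + z ≤ y + z → x ≤ y
  +-cancelʳ-≤ {x} {y} z x+z≤y+z = ≮⇒≥ λ y<x → ≤⇒≯ x+z≤y+z (+-monoˡ-< z y<x)

  difference : ∀ {x y} → x < y → ∃ λ h → 0# < h × x + h ≈ y
  difference {x} {y} x<y = y - x , 0<y-x , trans (+-comm x (y - x)) (x-y+y≈x y x)
    where
    0<y-x : 0# < y - x
    0<y-x = begin-strict
      0#    ≈⟨ -‿inverseʳ x ⟨
      x - x <⟨ +-monoˡ-< (- x) x<y ⟩
      y - x ∎

  neg-antimono-< : ∀ {x y} → x < y → - y < - x
  neg-antimono-< {x} {y} x<y = let h , 0<h , x+h≈y = difference x<y in begin-strict
    - y                ≈⟨ +-identityʳ (- y) ⟨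
    - y + 0#           ≈⟨ +-congˡ (-‿inverseʳ x) ⟨
    - y + (x - x)      ≈⟨ +-assoc (- y) x (- x) ⟨
    (- y + x) - x      <⟨ +-monoˡ-< (- x) (+-monoʳ-< (- y) x<y) ⟩
    (- y + y) - x      ≈⟨ +-congʳ (-‿inverseˡ y) ⟩
    0# - x             ≈⟨ +-identityˡ (- x) ⟩
    - x                ∎

  neg-antimono-≤ : ∀ {x y} → x ≤ y → - y ≤ - x
  neg-antimono-≤ (inj₁ x<y) = inj₁ (neg-antimono-< x<y)
  neg-antimono-≤ (inj₂ x≈y) = inj₂ (-‿cong (sym x≈y))

  *-nonneg : ∀ {x y} → 0# ≤ x → 0# ≤ y → 0# ≤ x * y
  *-nonneg (inj₁ 0<x) (inj₁ 0<y) = inj₁ (*-pos 0<x 0<y)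
  *-nonneg {x} {y} (inj₂ 0≈x) _ = inj₂ (trans (sym (zeroˡ y)) (*-congʳ 0≈x))
  *-nonneg {x} {y} (inj₁ _) (inj₂ 0≈y) = inj₂ (trans (sym (zeroʳ x)) (*-congˡ 0≈y))

  *-monoˡ-< : ∀ {x y z} → 0# < z → x < y → x * z < y * z
  *-monoˡ-< {x} {y} {z} 0<z x<y = let h , 0<h , x+h≈y = difference x<y in begin-strict
    x * z           <⟨ x<x+y (*-pos 0<h 0<z) ⟩
    x * z + h * z   ≈⟨ distribʳ z x h ⟨
    (x + h) * z     ≈⟨ *-congʳ x+h≈y ⟩
    y * z           ∎

  *-monoˡ-≤ : ∀ {x y z} → 0# ≤ z → x ≤ y → x * z ≤ y * z
  *-monoˡ-≤ 0≤z (inj₂ x≈y) = inj₂ (*-congʳ x≈y)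
  *-monoˡ-≤ (inj₁ 0<z) (inj₁ x<y) = inj₁ (*-monoˡ-< 0<z x<y)
  *-monoˡ-≤ {x} {y} {z} (inj₂ 0≈z) _ = inj₂
    (trans (*-congˡ (sym 0≈z)) (trans (zeroʳ x) (trans (sym (zeroʳ y)) (*-congˡ 0≈z))))

  *-monoʳ-≤ : ∀ {x y z} → 0# ≤ z → x ≤ y → z * x ≤ z * y
  *-monoʳ-≤ {x} {y} {z} 0≤z x≤y = begin
    z * x ≈⟨ *-comm z x ⟩
    x * z ≤⟨ *-monoˡ-≤ 0≤z x≤y ⟩
    y * z ≈⟨ *-comm y z ⟩
    z * y ∎

  *-mono-≤ : ∀ {x y u v} → 0# ≤ u → 0# ≤ y → x ≤ y → u ≤ v → x * u ≤ y * v
  *-mono-≤ 0≤u 0≤y x≤y u≤v = ≤-trans (*-monoˡ-≤ 0≤u x≤y) (*-monoʳ-≤ 0≤y u≤v)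

  ^-nonneg : ∀ {x} → 0# ≤ x → ∀ m → 0# ≤ x ^ m
  ^-nonneg 0≤x zero    = inj₁ 0<1
  ^-nonneg 0≤x (suc m) = *-nonneg 0≤x (^-nonneg 0≤x m)

  ^-pos : ∀ {x} → 0# < x → ∀ m → 0# < x ^ m
  ^-pos 0<x zero    = 0<1
  ^-pos 0<x (suc m) = *-pos 0<x (^-pos 0<x m)

  ^-monoˡ-≤ : ∀ {x y} → 0# ≤ x → x ≤ y → ∀ m → x ^ m ≤ y ^ m
  ^-monoˡ-≤ 0≤x x≤y zero    = ≤-refl
  ^-monoˡ-≤ 0≤x x≤y (suc m) =
    *-mono-≤ (^-nonneg 0≤x m) (≤-trans 0≤x x≤y) x≤y (^-monoˡ-≤ 0≤x x≤y m)

  module _ {z} (0<z : 0# < z) where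

    z≉0 : ¬ z ≈ 0#
    z≉0 z≈0 = Order.irrefl (sym z≈0) 0<z

    -- The proof that `z` is nonzero is the one used by `_/_[_]`, so `x * recip` and `x / z [ 0<z ]`
    -- unfold to the same term. Probabilities can thus be handled as products with `recip`.
    recip : Carrier
    recip = proj₁ (inverse z≉0)

    z*recip≈1 : z * recip ≈ 1#
    z*recip≈1 = proj₂ (inverse z≉0)

    recip-pos : 0# < recip
    recip-pos with Order.compare 0# recip
    ... | tri< 0<r _ _ = 0<r
    ... | tri≈ _ 0≈r _ = ⊥-elim (Order.irrefl (trans (sym (zeroʳ z)) (trans (*-congˡ 0≈r) z*recip≈1)) 0<1)
    ... | tri> _ _ r<0 = ⊥-elim (≤⇒≯ (inj₁ 1<0) 0<1)
      where
      1<0 : 1# < 0#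
      1<0 = begin-strict
        1#        ≈⟨ z*recip≈1 ⟨
        z * recip ≈⟨ *-comm z recip ⟩
        recip * z <⟨ *-monoˡ-< 0<z r<0 ⟩
        0# * z    ≈⟨ zeroˡ z ⟩
        0#        ∎

    -- Clears a denominator: with `z` the partition function, a lower bound on a probability becomes
    -- an inequality between unnormalised weights.
    *z≤⇒≤*recip : ∀ {t x} → t * z ≤ x → t ≤ x * recip
    *z≤⇒≤*recip {t} {x} tz≤x = begin
      t               ≈⟨ *-identityʳ t ⟨
      t * 1#          ≈⟨ *-congˡ z*recip≈1 ⟨
      t * (z * recip) ≈⟨ *-assoc t z recip ⟨
      (t * z) * recip ≤⟨ *-monoˡ-≤ (inj₁ recip-pos) tz≤x ⟩
      x * recip       ∎

    *recip*z : ∀ x → (x * recip) * z ≈ x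
    *recip*z x = begin-equality
      (x * recip) * z ≈⟨ *-assoc x recip z ⟩
      x * (recip * z) ≈⟨ *-congˡ (trans (*-comm recip z) z*recip≈1) ⟩
      x * 1#          ≈⟨ *-identityʳ x ⟩
      x               ∎

  -- Completeness speaks of suprema, so the set of all `- u m` is used; nonnegativity of `u` gives
  -- it the upper bound `0#`. The positive form of leastness turns into an explicit index `m` for
  -- every `y` above the infimum.
  infimum : (u : ℕ → Carrier) → (∀ m → 0# ≤ u m) →
            ∃ λ ℓ → (∀ m → ℓ ≤ u m) × (∀ {y} → ℓ < y → ∃ λ m → u m < y)
  infimum u 0≤u = - s , lower , greatest
    where
    S : Carrier → Set
    S y = ∃ λ m → y ≈ - u m

    bound : 0# IsUpperBoundOf S
    bound {x} (m , x≈-u) = begin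
      x     ≈⟨ x≈-u ⟩
      - u m ≤⟨ neg-antimono-≤ (0≤u m) ⟩
      - 0#  ≈⟨ -0#≈0# ⟩
      0#    ∎

    sup : ∃ (_IsSupremumOf S)
    sup = complete S (- u 0 , 0 , refl) (0# , bound)

    s = proj₁ sup

    lower : ∀ m → - s ≤ u m
    lower m = begin
      - s       ≤⟨ neg-antimono-≤ (proj₁ (proj₂ sup) (m , refl)) ⟩
      - (- u m) ≈⟨ -‿involutive (u m) ⟩
      u m       ∎

    greatest : ∀ {y} → - s < y → ∃ λ m → u m < y
    greatest {y} -s<y =
      let x , (m , x≈-u) , -y<x = proj₂ (proj₂ sup) -y<s in m , (begin-strict
        u m       ≈⟨ -‿involutive (u m) ⟨
        - (- u m) ≈⟨ -‿cong x≈-u ⟨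
        - x       <⟨ neg-antimono-< -y<x ⟩
        - (- y)   ≈⟨ -‿involutive y ⟩
        y         ∎)
      where
      -y<s : - y < s
      -y<s = begin-strict
        - y     <⟨ neg-antimono-< -s<y ⟩
        - (- s) ≈⟨ -‿involutive s ⟩
        s       ∎

  -- This is (1 - r)(1 + r) = 1 - r² < 1, scaled by `x`. Replacing `1#` by `q + r` avoids
  -- subtraction, so that the semiring solver applies: adding `x * (r * r)` completes the left side
  -- to `x` times the square of `q + r`.
  q[x+xr]<x : ∀ {q r x} → q + r ≈ 1# → 0# < x → 0# < r → q * (x + x * r) < x
  q[x+xr]<x {q} {r} {x} q+r≈1 0<x 0<r = begin-strict
    q * (x + x * r)
      ≈⟨ *-congˡ (+-congʳ x[q+r]≈x) ⟨
    q * (x * (q + r) + x * r)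
      <⟨ x<x+y (*-pos 0<x (*-pos 0<r 0<r)) ⟩
    q * (x * (q + r) + x * r) + x * (r * r)
      ≈⟨ solve 3 (λ q x r → q :* (x :* (q :+ r) :+ x :* r) :+ x :* (r :* r)
                := (x :* (q :+ r)) :* (q :+ r)) refl q x r ⟩
    (x * (q + r)) * (q + r)
      ≈⟨ *-cong x[q+r]≈x q+r≈1 ⟩
    x * 1#
      ≈⟨ *-identityʳ x ⟩
    x ∎
    where
    x[q+r]≈x : x * (q + r) ≈ x
    x[q+r]≈x = trans (*-congˡ q+r≈1) (*-identityʳ x)

  -- If the infimum ℓ of the powers of q = 1 - r were positive, some power would
  -- fall below ℓ(1 + r), and the next one below ℓ(1 + r)(1 - r) < ℓ.
  infimum-of-powers≤0 : ∀ {q r ℓ} → 0# ≤ q → 0# < r → q + r ≈ 1# → (∀ m → ℓ ≤ q ^ m) →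
                        (∀ {y} → ℓ < y → ∃ λ m → q ^ m < y) → ℓ ≤ 0#
  infimum-of-powers≤0 {q} {r} {ℓ} 0≤q 0<r q+r≈1 lower greatest =
    ≮⇒≥ λ 0<ℓ → contradiction 0<ℓ (greatest (x<x+y (*-pos 0<ℓ 0<r)))
    where
    contradiction : 0# < ℓ → ¬ (∃ λ m → q ^ m < ℓ + ℓ * r)
    contradiction 0<ℓ (m , q^m<ℓ+ℓr) = ≤⇒≯ (lower (suc m)) (begin-strict
      q * q ^ m         ≤⟨ *-monoʳ-≤ 0≤q (inj₁ q^m<ℓ+ℓr) ⟩
      q * (ℓ + ℓ * r)   <⟨ q[x+xr]<x q+r≈1 0<ℓ 0<r ⟩
      ℓ                 ∎)

  -- The powers have an infimum, which is at most `0#` and hence below `ε`; a number above the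
  -- infimum lies above some power. Completeness is used here directly, with no detour through the
  -- Archimedean property.
  ^-decay : ∀ {q ε} → 0# ≤ q → q < 1# → 0# < ε → ∃ λ m → q ^ m < ε
  ^-decay {q} {ε} 0≤q q<1 0<ε =
    let r , 0<r , q+r≈1 = difference q<1
        ℓ , lower , greatest = infimum (q ^_) (^-nonneg 0≤q)
        ℓ≤0 = infimum-of-powers≤0 0≤q 0<r q+r≈1 lower greatest
    in greatest (NonStrict.≤-<-trans sym Order.trans Order.<-respˡ-≈ ℓ≤0 0<ε)

  -- The ratio d/a lies in [0,1), so its powers decay; multiplying by `a ^ m` gives the bound.
  ^-dominates : ∀ {a d ε} → 0# ≤ d → d < a → 0# < ε → ∃ λ m → d ^ m ≤ ε * a ^ m
  ^-dominates {a} {d} {ε} 0≤d d<a 0<ε = m , (begin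
    d ^ m                   ≈⟨ ^-congˡ m (*recip*z 0<a d) ⟨
    (d * recip 0<a * a) ^ m ≈⟨ ^-distrib-* (d * recip 0<a) a m ⟩
    (d * recip 0<a) ^ m * a ^ m ≤⟨ *-monoˡ-≤ (^-nonneg (inj₁ 0<a) m) (inj₁ (proj₂ decay)) ⟩
    ε * a ^ m               ∎)
    where
    0<a : 0# < a
    0<a = begin-strict 0# ≤⟨ 0≤d ⟩ d <⟨ d<a ⟩ a ∎

    q<1 : d * recip 0<a < 1#
    q<1 = begin-strict
      d * recip 0<a <⟨ *-monoˡ-< (recip-pos 0<a) d<a ⟩
      a * recip 0<a ≈⟨ z*recip≈1 0<a ⟩
      1#            ∎

    decay : ∃ λ m → (d * recip 0<a) ^ m < ε
    decay = ^-decay (*-nonneg 0≤d (inj₁ (recip-pos 0<a))) q<1 0<ε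

    m = proj₁ decay

  -- Both bases are bounded by their maximum `d`, which is still below `a`, so a single exponent
  -- serves both; each term receives half of `ε`. In the partition function this makes the two
  -- weaker spin pairs negligible.
  ^-dominates-sum : ∀ {a b c ε} → 0# ≤ b → 0# ≤ c → b < a → c < a → 0# < ε →
                    ∃ λ m → b ^ m + c ^ m ≤ ε * a ^ m
  ^-dominates-sum {a} {b} {c} {ε} 0≤b 0≤c b<a c<a 0<ε = m , (begin
    b ^ m + c ^ m
      ≤⟨ +-mono-≤ (^-monoˡ-≤ 0≤b b≤d m) (^-monoˡ-≤ 0≤c c≤d m) ⟩
    d ^ m + d ^ m
      ≤⟨ +-mono-≤ d^m≤ d^m≤ ⟩
    (ε * recip 0<2) * a ^ m + (ε * recip 0<2) * a ^ m
      ≈⟨ x+x≈2x ((ε * recip 0<2) * a ^ m) ⟩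
    2# * ((ε * recip 0<2) * a ^ m)
      ≈⟨ *-assoc 2# (ε * recip 0<2) (a ^ m) ⟨
    (2# * (ε * recip 0<2)) * a ^ m
      ≈⟨ *-congʳ (*-comm 2# (ε * recip 0<2)) ⟩
    ((ε * recip 0<2) * 2#) * a ^ m
      ≈⟨ *-congʳ (*recip*z 0<2 ε) ⟩
    ε * a ^ m ∎)
    where
    max : ∃ λ d → b ≤ d × c ≤ d × d < a
    max with ≤-total b c
    ... | inj₁ b≤c = c , b≤c , ≤-refl , c<a
    ... | inj₂ c≤b = b , ≤-refl , c≤b , b<a

    d = proj₁ max

    b≤d : b ≤ d
    b≤d = proj₁ (proj₂ max)

    c≤d : c ≤ d
    c≤d = proj₁ (proj₂ (proj₂ max))

    dominates : ∃ λ m → d ^ m ≤ (ε * recip 0<2) * a ^ m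
    dominates = ^-dominates (≤-trans 0≤b b≤d) (proj₂ (proj₂ (proj₂ max))) (*-pos 0<ε (recip-pos 0<2))

    m = proj₁ dominates

    d^m≤ : d ^ m ≤ (ε * recip 0<2) * a ^ m
    d^m≤ = proj₂ dominates

  -- With y = x + h, the two sides differ by h².
  double-product<sum-of-squares : ∀ {x y} → x < y → x * y + x * y < x * x + y * y
  double-product<sum-of-squares {x} {y} x<y = let h , 0<h , x+h≈y = difference x<y in begin-strict
    x * y + x * y                           ≈⟨ +-cong (*-congˡ x+h≈y) (*-congˡ x+h≈y) ⟨
    x * (x + h) + x * (x + h)               <⟨ x<x+y (*-pos 0<h 0<h) ⟩
    x * (x + h) + x * (x + h) + h * h       ≈⟨ solve 2 (λ x h → x :* (x :+ h) :+ x :* (x :+ h) :+ h :* h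
                                                       := x :* x :+ (x :+ h) :* (x :+ h)) refl x h ⟩
    x * x + (x + h) * (x + h)               ≈⟨ +-congˡ (*-cong x+h≈y x+h≈y) ⟩
    x * x + y * y                           ∎

  -- The equality case keeps `x ≈ y` as evidence, so that `sum-dichotomy` can collect it over all
  -- configurations.
  am-gm : ∀ x y → (x ≈ y × x * y + x * y ≈ x * x + y * y) ⊎ x * y + x * y < x * x + y * y
  am-gm x y with Order.compare x y
  ... | tri< x<y _ _ = inj₂ (double-product<sum-of-squares x<y)
  ... | tri≈ _ x≈y _ = inj₁ (x≈y , +-cong (*-congˡ (sym x≈y)) (*-congʳ x≈y))
  ... | tri> _ _ y<x = inj₂ (begin-strict
    x * y + x * y ≈⟨ +-cong (*-comm x y) (*-comm x y) ⟩
    y * x + y * x <⟨ double-product<sum-of-squares y<x ⟩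
    y * y + x * x ≈⟨ +-comm (y * y) (x * x) ⟩
    x * x + y * y ∎)

  -- If `x` were at least `z`, it would be at least `y` as well, and the doubled `x` would reach
  -- `y + z`.
  double<sum⇒<max : ∀ {x y z} → y ≤ z → x + x < y + z → x < z
  double<sum⇒<max {x} {y} {z} y≤z x+x<y+z with Order.compare x z
  ... | tri< x<z _ _ = x<z
  ... | tri≈ _ x≈z _ = ⊥-elim (≤⇒≯ (+-mono-≤ (≤-trans y≤z (inj₂ (sym x≈z))) (inj₂ (sym x≈z))) x+x<y+z)
  ... | tri> _ _ z<x = ⊥-elim (≤⇒≯ (+-mono-≤ (≤-trans y≤z (inj₁ z<x)) (inj₁ z<x)) x+x<y+z)

  -- Here `p` is the weight of the wanted event, `q` the remaining weight and `p + q` the total.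
  -- Adding `ε * (p + q)` to both sides removes the subtraction and leaves a consequence of
  -- `q ≤ ε * p`.
  ε-small⇒ : ∀ {ε p q} → 0# ≤ q → 0# < ε → q ≤ ε * p → (1# - ε) * (p + q) ≤ p
  ε-small⇒ {ε} {p} {q} 0≤q 0<ε q≤εp = +-cancelʳ-≤ (ε * (p + q)) (begin
    (1# - ε) * (p + q) + ε * (p + q) ≈⟨ distribʳ (p + q) (1# - ε) ε ⟨
    ((1# - ε) + ε) * (p + q)         ≈⟨ *-congʳ (x-y+y≈x 1# ε) ⟩
    1# * (p + q)                     ≈⟨ *-identityˡ (p + q) ⟩
    p + q                            ≤⟨ +-monoʳ-≤ p q≤εp ⟩
    p + ε * p                        ≤⟨ +-monoʳ-≤ p (*-monoʳ-≤ (inj₁ 0<ε) (x≤x+y 0≤q)) ⟩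
    p + ε * (p + q)                  ∎)

-- Sums over all configurations.

module ConfigurationSums (ℝ : Reals) where
  open Reals ℝ hiding (zero)
  open Spin ℝ using (sumConfigurations)
  open OrderedField ℝ
  open ≤-Reasoning

  sum-cong : ∀ n {g h : Configuration n → Carrier} → (∀ σ → g σ ≈ h σ) →
             sumConfigurations n g ≈ sumConfigurations n h
  sum-cong zero    g≈h = g≈h []
  sum-cong (suc n) g≈h = +-cong (sum-cong n λ σ → g≈h (false ∷ σ)) (sum-cong n λ σ → g≈h (true ∷ σ))

  sum-distribʳ : ∀ n (g : Configuration n → Carrier) c →
                 sumConfigurations n (λ σ → g σ * c) ≈ sumConfigurations n g * c
  sum-distribʳ zero    g c = refl
  sum-distribʳ (suc n) g c =
    trans (+-cong (sum-distribʳ n _ c) (sum-distribʳ n _ c)) (sym (distribʳ c _ _))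

  sum-distribˡ : ∀ n (g : Configuration n → Carrier) c →
                 sumConfigurations n (λ σ → c * g σ) ≈ c * sumConfigurations n g
  sum-distribˡ zero    g c = refl
  sum-distribˡ (suc n) g c =
    trans (+-cong (sum-distribˡ n _ c) (sum-distribˡ n _ c)) (sym (distribˡ c _ _))

  sum-zero : ∀ n → sumConfigurations n (λ _ → 0#) ≈ 0#
  sum-zero zero    = refl
  sum-zero (suc n) = trans (+-cong (sum-zero n) (sum-zero n)) (+-identityʳ 0#)

  sum-+ : ∀ n (g h : Configuration n → Carrier) →
          sumConfigurations n (λ σ → g σ + h σ) ≈ sumConfigurations n g + sumConfigurations n h
  sum-+ zero    g h = refl
  sum-+ (suc n) g h = trans (+-cong (sum-+ n _ _) (sum-+ n _ _))
    (solve 4 (λ a b c d → (a :+ b) :+ (c :+ d) := (a :+ c) :+ (b :+ d)) refl _ _ _ _)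

  sum-++ : ∀ m {n} (g : Configuration (m +ℕ n) → Carrier) →
           sumConfigurations (m +ℕ n) g ≈
           sumConfigurations m (λ σ → sumConfigurations n (λ τ → g (σ ++ τ)))
  sum-++ zero    g = refl
  sum-++ (suc m) g = +-cong (sum-++ m _) (sum-++ m _)

  sum-nonneg : ∀ n {g : Configuration n → Carrier} → (∀ σ → 0# ≤ g σ) → 0# ≤ sumConfigurations n g
  sum-nonneg zero    0≤g = 0≤g []
  sum-nonneg (suc n) 0≤g =
    +-nonneg (sum-nonneg n λ σ → 0≤g (false ∷ σ)) (sum-nonneg n λ σ → 0≤g (true ∷ σ))

  -- A single strict term makes the whole sum strict, since every other term is at most its
  -- counterpart. Otherwise every term is in the equality case, and its witnesses of `P` together
  -- cover all configurations.
  sum-dichotomy : ∀ n {g h : Configuration n → Carrier} {P : Configuration n → Set} →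
                  (∀ σ → (P σ × g σ ≈ h σ) ⊎ g σ < h σ) →
                  ((∀ σ → P σ) × sumConfigurations n g ≈ sumConfigurations n h) ⊎
                  sumConfigurations n g < sumConfigurations n h
  sum-dichotomy zero d with d []
  ... | inj₁ (p , g≈h) = inj₁ ((λ { [] → p }) , g≈h)
  ... | inj₂ g<h = inj₂ g<h
  sum-dichotomy (suc n) d
    with sum-dichotomy n (λ σ → d (false ∷ σ)) | sum-dichotomy n (λ σ → d (true ∷ σ))
  ... | inj₁ (p₀ , eq₀) | inj₁ (p₁ , eq₁) =
    inj₁ ((λ { (false ∷ σ) → p₀ σ ; (true ∷ σ) → p₁ σ }) , +-cong eq₀ eq₁)
  ... | inj₁ (_ , eq₀)  | inj₂ lt₁ = inj₂ (+-mono-≤-< (inj₂ eq₀) lt₁)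
  ... | inj₂ lt₀ | inj₁ (_ , eq₁)  = inj₂ (+-mono-<-≤ lt₀ (inj₂ eq₁))
  ... | inj₂ lt₀ | inj₂ lt₁        = inj₂ (+-mono-<-≤ lt₀ (inj₁ lt₁))

-- Symmetric functions insensitive to one argument.

module SymmetricFunctions (ℝ : Reals) where
  open Reals ℝ hiding (zero)
  open Spin ℝ

  -- The entries of `x` are replaced by those of `y` from left to right; in the recursion the entry
  -- already replaced stays as a fixed prefix of the argument.
  update-invariant⇒constant : ∀ n {g : Vec Bool n → Carrier} →
    (∀ i x b → g (x [ i ]≔ b) ≈ g x) → ∀ x y → g x ≈ g y
  update-invariant⇒constant zero    inv []      []      = refl
  update-invariant⇒constant (suc n) inv (a ∷ x) (b ∷ y) =
    trans (sym (inv zero (a ∷ x) b))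
          (update-invariant⇒constant n (λ i z → inv (suc i) (b ∷ z)) x y)

  -- By symmetry, position `i` can be exchanged with the head, so invariance under changing the head
  -- gives invariance under changing any entry.
  head-invariant⇒constant : ∀ {j} (f : Vec Bool (suc j) → Carrier) → Symmetric f →
    (∀ x → f (false ∷ x) ≈ f (true ∷ x)) → Constant f
  head-invariant⇒constant {j} f symmetric head-inv =
    f (replicate _ false) ,
    λ x → update-invariant⇒constant (suc j) update-inv x (replicate _ false)
    where
    head-inv′ : ∀ a b x → f (a ∷ x) ≈ f (b ∷ x)
    head-inv′ false false x = refl
    head-inv′ false true  x = head-inv x
    head-inv′ true  false x = sym (head-inv x)
    head-inv′ true  true  x = refl

    update-inv : ∀ i x b → f (x [ i ]≔ b) ≈ f x
    update-inv i x b =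
      -- Both vectors are permuted by `π`. Afterwards they differ at most in the head, where the
      -- entry from position `i` now stands.
      trans (sym (symmetric π (x [ i ]≔ b)))
     (trans (reflexive (cong (λ t → f (lookup (x [ i ]≔ b) i ∷ t)) same-tail))
     (trans (head-inv′ _ _ _) (symmetric π x)))
      where
      π : Permutation′ (suc j)
      π = transpose zero i

      moved : ∀ l → π ⟨$⟩ʳ suc l ≢ i
      -- `π ⟨$⟩ʳ zero` computes to `i`, so injectivity of `π` would identify `suc l` with `zero`.
      moved l π[1+l]≡i with Injection.injective (↔⇒↣ π) {suc l} {zero} π[1+l]≡i
      ... | ()

      same-tail : tabulate (λ l → lookup (x [ i ]≔ b) (π ⟨$⟩ʳ suc l)) ≡
                  tabulate (λ l → lookup x (π ⟨$⟩ʳ suc l))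
      same-tail = tabulate-cong λ l → lookup∘updateAt′ _ i (moved l) x

-- The double-star hypergraph.

module Blocks (j : ℕ) (0<j : 1 ≤ℕ j) where

  ∣⊤++⊥∣ : ∀ i n → ∣ ⊤ {i} ++ ⊥ {n} ∣ ≡ i
  ∣⊤++⊥∣ zero    n = ∣⊥∣≡0 n
  ∣⊤++⊥∣ (suc i) n = cong suc (∣⊤++⊥∣ i n)

  ∣⊥++e∣ : ∀ i {n} (e : Subset n) → ∣ ⊥ {i} ++ e ∣ ≡ ∣ e ∣
  ∣⊥++e∣ zero    e = ≡.refl
  ∣⊥++e∣ (suc i) e = ∣⊥++e∣ i e

  cast-[] : ∀ {n} .(p : n ≡ 0) (x : Vec Bool n) → cast p x ≡ []
  cast-[] p [] = ≡.refl

  restrict-⊤++⊥ : ∀ i n .(p : ∣ ⊤ {i} ++ ⊥ {n} ∣ ≡ i) (x : Vec Bool i) (y : Vec Bool n) →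
                  cast p (restrict (⊤ {i} ++ ⊥ {n}) (x ++ y)) ≡ x
  restrict-⊤++⊥ zero    n p []      y = cast-[] p (restrict (⊥ {n}) y)
  restrict-⊤++⊥ (suc i) n p (s ∷ x) y = cong (s ∷_) (restrict-⊤++⊥ i n (cong pred p) x y)

  restrict-⊥++e : ∀ i {n k} (e : Subset n) .(p : ∣ ⊥ {i} ++ e ∣ ≡ k) .(q : ∣ e ∣ ≡ k)
                  (x : Vec Bool i) (y : Vec Bool n) →
                  cast p (restrict (⊥ {i} ++ e) (x ++ y)) ≡ cast q (restrict e y)
  restrict-⊥++e zero    e p q []      y = ≡.refl
  restrict-⊥++e (suc i) e p q (s ∷ x) y = restrict-⊥++e i e p q x y

  Edge : ℕ → ℕ → Set
  Edge n k = Σ (Subset n) λ e → ∣ e ∣ ≡ k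

  shift : ∀ i {n k} → Edge n k → Edge (i +ℕ n) k
  shift i (e , p) = ⊥ {i} ++ e , ≡.trans (∣⊥++e∣ i e) p

  -- These are disjoint sets of size `j`, one less than the edge size; the missing vertex is a
  -- terminal, supplied by `edge₀` or `edge₁`. Putting the new block in front lets a configuration
  -- split as `x ++ σ` in the induction on `m`.
  blocks : ∀ m → List (Edge (m *ℕ j) j)
  blocks zero    = []
  blocks (suc m) = (⊤ {j} ++ ⊥ {m *ℕ j} , ∣⊤++⊥∣ j (m *ℕ j)) ∷ map (shift j) (blocks m)

  -- The two sets already differ at their first vertex, which exists because `i` is positive. With
  -- empty blocks all of them would coincide and the edges would repeat; the hypothesis `2 ≤ℕ k`
  -- rules this out.
  ⊤++⊥≢⊥++e : ∀ {i n} → 1 ≤ℕ i → {e : Subset n} → ⊤ {i} ++ ⊥ {n} ≢ ⊥ {i} ++ e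
  ⊤++⊥≢⊥++e (s≤s _) ()

  blocks-unique : ∀ m → Unique (map proj₁ (blocks m))
  blocks-unique zero    = []
  blocks-unique (suc m) =
    subst (λ es → Unique ((⊤ {j} ++ ⊥ {m *ℕ j}) ∷ es)) shifted
      (All.map⁺ (All.universal (λ e → ⊤++⊥≢⊥++e 0<j) (map proj₁ (blocks m))) ∷
       Unique.map⁺ (++-injectiveʳ ⊥ ⊥) (blocks-unique m))
    where
    shifted : map (⊥ {j} ++_) (map proj₁ (blocks m)) ≡ map proj₁ (map (shift j) (blocks m))
    -- Both sides are fused into one `map`: prefixing after `proj₁` and `proj₁` after `shift j`
    -- agree by computation.
    shifted = ≡.trans (≡.sym (map-∘ (blocks m))) (map-∘ (blocks m))

  edge₀ edge₁ : ∀ {n} → Edge n j → Edge (2 +ℕ n) (suc j)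
  edge₀ (e , p) = inside ∷ outside ∷ e , cong suc p
  edge₁ (e , p) = outside ∷ inside ∷ e , cong suc p

  -- Vertices 0 and 1 are the terminals u and v.
  doubleStar : ∀ m → Hypergraph (suc j) (2 +ℕ m *ℕ j)
  doubleStar m = record
    { hyperedges = map edge₀ (blocks m) ++ₗ map edge₁ (blocks m)
    ; distinct   = subst Unique edges≡
        (Unique.++⁺ (Unique.map⁺ (λ { ≡.refl → ≡.refl }) (blocks-unique m))
                    (Unique.map⁺ (λ { ≡.refl → ≡.refl }) (blocks-unique m))
                    disjoint)
    }
    where
    es = map proj₁ (blocks m)

    edges≡ : map (λ e → inside ∷ outside ∷ e) es ++ₗ map (λ e → outside ∷ inside ∷ e) es ≡
             map proj₁ (map edge₀ (blocks m) ++ₗ map edge₁ (blocks m))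
    edges≡ = ≡.trans
      (cong₂ _++ₗ_ (≡.trans (≡.sym (map-∘ (blocks m))) (map-∘ (blocks m)))
                   (≡.trans (≡.sym (map-∘ (blocks m))) (map-∘ (blocks m))))
      (≡.sym (map-++ proj₁ (map edge₀ (blocks m)) (map edge₁ (blocks m))))

    disjoint : Disjoint (map (λ e → inside ∷ outside ∷ e) es) (map (λ e → outside ∷ inside ∷ e) es)
    -- A common edge would have to contain vertex 0 and also omit it.
    disjoint (v∈₀ , v∈₁) with ∈-map⁻ _ v∈₀ | ∈-map⁻ _ v∈₁
    ... | _ , _ , ≡.refl | _ , _ , ()

-- The partition function and marginals of the double star.

module DoubleStar (ℝ : Reals) (j : ℕ) (0<j : 1 ≤ℕ j)
                  (f : Vec Bool (suc j) → Reals.Carrier ℝ) where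
  open Reals ℝ hiding (zero)
  open Spin ℝ
  open OrderedField ℝ
  open ConfigurationSums ℝ
  open Blocks j 0<j
  open ≤-Reasoning

  product : ∀ {n k} → (Vec Bool k → Carrier) → List (Edge n k) → Configuration n → Carrier
  product g es σ = foldr (λ (e , p) w → g (cast p (restrict e σ)) * w) 1# es

  product-++ : ∀ {n k} (g : Vec Bool k → Carrier) (es es′ : List (Edge n k)) σ →
               product g (es ++ₗ es′) σ ≈ product g es σ * product g es′ σ
  product-++ g []       es′ σ = sym (*-identityˡ _)
  product-++ g (e ∷ es) es′ σ = trans (*-congˡ (product-++ g es es′ σ)) (sym (*-assoc _ _ _))

  product-map : ∀ {n n′ k k′} (g : Vec Bool k → Carrier) (g′ : Vec Bool k′ → Carrier)
                (t : Edge n k → Edge n′ k′) {σ : Configuration n} {σ′ : Configuration n′} →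
                (∀ e → g′ (cast (proj₂ (t e)) (restrict (proj₁ (t e)) σ′)) ≈
                       g (cast (proj₂ e) (restrict (proj₁ e) σ))) →
                ∀ es → product g′ (map t es) σ′ ≈ product g es σ
  product-map g g′ t eq []       = refl
  product-map g g′ t eq (e ∷ es) = *-cong (eq e) (product-map g g′ t eq es)

  starWeight : ∀ m → Bool → Configuration (m *ℕ j) → Carrier
  starWeight m a = product (λ x → f (a ∷ x)) (blocks m)

  -- Once the spins of the terminals are fixed, the edges at u and those at v contribute separate
  -- factors. On each edge `restrict` drops the other terminal by computation, which is why `refl`
  -- suffices edge by edge.
  weight-doubleStar : ∀ m a b σ →
    weight f (doubleStar m) (a ∷ b ∷ σ) ≈ starWeight m a σ * starWeight m b σ
  weight-doubleStar m a b σ =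
    trans (product-++ f (map edge₀ (blocks m)) (map edge₁ (blocks m)) (a ∷ b ∷ σ))
          (*-cong (product-map (λ x → f (a ∷ x)) f edge₀ (λ e → refl) (blocks m))
                  (product-map (λ x → f (b ∷ x)) f edge₁ (λ e → refl) (blocks m)))

  starWeight-suc : ∀ m a x σ → starWeight (suc m) a (x ++ σ) ≈ f (a ∷ x) * starWeight m a σ
  starWeight-suc m a x σ = *-cong
    (reflexive (cong (λ z → f (a ∷ z)) (restrict-⊤++⊥ j (m *ℕ j) (∣⊤++⊥∣ j (m *ℕ j)) x σ)))
    (product-map (λ y → f (a ∷ y)) (λ y → f (a ∷ y)) (shift j)
      (λ (e , p) → reflexive (cong (λ y → f (a ∷ y))
        (restrict-⊥++e j e (≡.trans (∣⊥++e∣ j e) p) p x σ)))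
      (blocks m))

  -- The quantity T(a,b): the Gram matrix of the two functions obtained from `f` by fixing its first
  -- argument.
  interaction : Bool → Bool → Carrier
  interaction a b = sumConfigurations j λ x → f (a ∷ x) * f (b ∷ x)

  interaction-comm : ∀ a b → interaction a b ≈ interaction b a
  interaction-comm a b = sum-cong j λ x → *-comm _ _

  -- The blocks are disjoint, so the sum over their spins factorises, and each block contributes one
  -- factor `interaction a b`.
  sum-starWeight : ∀ m a b →
    sumConfigurations (m *ℕ j) (λ σ → starWeight m a σ * starWeight m b σ) ≈ interaction a b ^ m
  sum-starWeight zero    a b = *-identityˡ 1#
  sum-starWeight (suc m) a b = begin-equality
    sumConfigurations (j +ℕ m *ℕ j) (λ σ → starWeight (suc m) a σ * starWeight (suc m) b σ)
      ≈⟨ sum-++ j _ ⟩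
    sumConfigurations j (λ x → sumConfigurations (m *ℕ j) λ σ →
      starWeight (suc m) a (x ++ σ) * starWeight (suc m) b (x ++ σ))
      ≈⟨ sum-cong j (λ x → trans (sum-cong (m *ℕ j) (λ σ → regroup x σ)) (sum-distribˡ (m *ℕ j) _ _)) ⟩
    sumConfigurations j (λ x → (f (a ∷ x) * f (b ∷ x)) *
      sumConfigurations (m *ℕ j) (λ σ → starWeight m a σ * starWeight m b σ))
      ≈⟨ sum-distribʳ j _ _ ⟩
    interaction a b * sumConfigurations (m *ℕ j) (λ σ → starWeight m a σ * starWeight m b σ)
      ≈⟨ *-congˡ (sum-starWeight m a b) ⟩
    interaction a b * interaction a b ^ m ∎
    where
    regroup : ∀ x σ → starWeight (suc m) a (x ++ σ) * starWeight (suc m) b (x ++ σ) ≈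
                      (f (a ∷ x) * f (b ∷ x)) * (starWeight m a σ * starWeight m b σ)
    regroup x σ = trans (*-cong (starWeight-suc m a x σ) (starWeight-suc m b x σ))
      (solve 4 (λ p q r s → (p :* q) :* (r :* s) := (p :* r) :* (q :* s)) refl _ _ _ _)

  sum-weight : ∀ m a b →
    sumConfigurations (m *ℕ j) (λ σ → weight f (doubleStar m) (a ∷ b ∷ σ)) ≈ interaction a b ^ m
  sum-weight m a b = trans (sum-cong (m *ℕ j) (weight-doubleStar m a b)) (sum-starWeight m a b)

  Z-doubleStar : ∀ m → Z f (doubleStar m) ≈
    (interaction false false ^ m + interaction false true ^ m) +
    (interaction true false ^ m + interaction true true ^ m)
  Z-doubleStar m = +-cong (+-cong (sum-weight m false false) (sum-weight m false true))
                          (+-cong (sum-weight m true false) (sum-weight m true true))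

  module _ (m : ℕ) (Z>0 : 0# < Z f (doubleStar m)) where

    sum-μ : ∀ a b → sumConfigurations (m *ℕ j) (λ σ → μ f (doubleStar m) Z>0 (a ∷ b ∷ σ)) ≈
                    interaction a b ^ m * recip Z>0
    sum-μ a b = trans (sum-distribʳ (m *ℕ j) _ _) (*-congʳ (sum-weight m a b))

    sum-0 : sumConfigurations (m *ℕ j) (λ _ → 0#) ≈ 0#
    sum-0 = sum-zero (m *ℕ j)

    -- The test looks only at the leading spin, so it computes once the terminal spins are given:
    -- each of the four partial sums is either a full sum of `μ` or a sum of `0#`.
    probability-terminal : ∀ s → probability f (doubleStar m) Z>0 (λ σ → lookup σ zero ≟ s) ≈
      (interaction s false ^ m + interaction s true ^ m) * recip Z>0
    probability-terminal false = trans
      (+-cong (+-cong (sum-μ false false) (sum-μ false true)) (+-cong sum-0 sum-0))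
      (solve 3 (λ a b z → (a :* z :+ b :* z) :+ (con 0 :+ con 0) := (a :+ b) :* z) refl _ _ _)
    probability-terminal true = trans
      (+-cong (+-cong sum-0 sum-0) (+-cong (sum-μ true false) (sum-μ true true)))
      (solve 3 (λ a b z → (con 0 :+ con 0) :+ (a :* z :+ b :* z) := (a :+ b) :* z) refl _ _ _)

    probability-equal : ∀ s →
      probability f (doubleStar m) Z>0 (λ σ → all? (λ i → lookup σ (i ↑ˡ (m *ℕ j)) ≟ s)) ≈
      interaction s s ^ m * recip Z>0
    probability-equal false = trans
      (+-cong (+-cong (sum-μ false false) sum-0) (+-cong sum-0 sum-0))
      (solve 1 (λ a → (a :+ con 0) :+ (con 0 :+ con 0) := a) refl _)
    probability-equal true = trans
      (+-cong (+-cong sum-0 sum-0) (+-cong sum-0 (sum-μ true true)))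
      (solve 1 (λ a → (con 0 :+ con 0) :+ (con 0 :+ a) := a) refl _)

  -- Pinning and equality from the dominating interaction.

  module _ (nonneg : NonNegative f) where

    interaction-nonneg : ∀ a b → 0# ≤ interaction a b
    interaction-nonneg a b = sum-nonneg j λ x → *-nonneg (nonneg (a ∷ x)) (nonneg (b ∷ x))

    pinning : ∀ s → interaction (not s) (not s) < interaction s s →
              interaction s (not s) < interaction s s → SupportsPinning f s
    pinning s B<A C<A ε 0<ε =
      case ^-dominates-sum (interaction-nonneg _ _) (interaction-nonneg _ _) B<A C<A 0<ε of
      λ (m , dominates) → _ , doubleStar m , zero , Z>0 m dominates , bound m dominates
      where
      A = interaction s s
      B = interaction (not s) (not s)
      C = interaction s (not s)

      0<A : 0# < A
      0<A = begin-strict 0# ≤⟨ interaction-nonneg _ _ ⟩ B <⟨ B<A ⟩ A ∎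

      module _ (m : ℕ) (dominates : B ^ m + C ^ m ≤ ε * A ^ m) where

        -- `P` is the total weight with u in state `s`, and `Q` the total weight with u in the other
        -- state, where symmetry of `interaction` has been used to write the mixed term as `C`.
        P = A ^ m + C ^ m
        Q = B ^ m + C ^ m

        P≈ : ∀ s → interaction s false ^ m + interaction s true ^ m ≈
                   interaction s s ^ m + interaction s (not s) ^ m
        P≈ false = refl
        P≈ true  = +-comm _ _

        Z≈ : Z f (doubleStar m) ≈ P + Q
        Z≈ = trans (Z-doubleStar m) (rearrange s)
          where
          rearrange : ∀ s → (interaction false false ^ m + interaction false true ^ m) +
                            (interaction true false ^ m + interaction true true ^ m) ≈
                            (interaction s s ^ m + interaction s (not s) ^ m) +
                            (interaction (not s) (not s) ^ m + interaction s (not s) ^ m)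
          rearrange false = +-congˡ (trans (+-comm _ _) (+-congˡ (^-congˡ m (interaction-comm true false))))
          rearrange true  = trans (+-congʳ (+-congˡ (^-congˡ m (interaction-comm false true))))
                           (trans (+-comm _ _) (+-congʳ (+-comm _ _)))

        0<P : 0# < P
        0<P = begin-strict
          0#            <⟨ ^-pos 0<A m ⟩
          A ^ m         ≤⟨ x≤x+y (^-nonneg (interaction-nonneg _ _) m) ⟩
          A ^ m + C ^ m ∎

        0≤Q : 0# ≤ Q
        0≤Q = +-nonneg (^-nonneg (interaction-nonneg _ _) m) (^-nonneg (interaction-nonneg _ _) m)

        Q≤εP : Q ≤ ε * P
        Q≤εP = ≤-trans dominates
          (*-monoʳ-≤ (inj₁ 0<ε) (x≤x+y (^-nonneg (interaction-nonneg _ _) m)))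

        Z>0 : 0# < Z f (doubleStar m)
        Z>0 = begin-strict
          0#    <⟨ 0<P ⟩
          P     ≤⟨ x≤x+y 0≤Q ⟩
          P + Q ≈⟨ Z≈ ⟨
          Z f (doubleStar m) ∎

        bound : 1# - ε ≤ probability f (doubleStar m) Z>0 (λ σ → lookup σ zero ≟ s)
        bound = ≤-trans
          (*z≤⇒≤*recip Z>0 (begin
            (1# - ε) * Z f (doubleStar m) ≈⟨ *-congˡ Z≈ ⟩
            (1# - ε) * (P + Q)            ≤⟨ ε-small⇒ 0≤Q 0<ε Q≤εP ⟩
            P                             ≈⟨ P≈ s ⟨
            interaction s false ^ m + interaction s true ^ m ∎))
          (inj₂ (sym (probability-terminal m Z>0 s)))

    equality : interaction false false ≈ interaction true true →
               interaction false true < interaction false false → SupportsEquality f 2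
    equality A≈B C<A ε 0<ε =
      -- Both competitors are taken to be `C`; the term `C ^ m` needed in `bound` is at most their
      -- sum.
      case ^-dominates-sum (interaction-nonneg _ _) (interaction-nonneg _ _) C<A C<A 0<ε of
      λ (m , dominates) → _ , doubleStar m , (_↑ˡ (m *ℕ j)) , (λ {x} {y} → ↑ˡ-injective (m *ℕ j) x y) ,
         Z>0 m dominates , λ s →
         ≤-trans (*z≤⇒≤*recip (Z>0 m dominates) (bound m dominates s))
                 (inj₂ (sym (probability-equal m (Z>0 m dominates) s)))
      where
      A = interaction false false
      C = interaction false true

      0<A : 0# < A
      0<A = begin-strict 0# ≤⟨ interaction-nonneg _ _ ⟩ C <⟨ C<A ⟩ A ∎

      module _ (m : ℕ) (dominates : C ^ m + C ^ m ≤ ε * A ^ m) where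

        0≤C^m : 0# ≤ C ^ m
        0≤C^m = ^-nonneg (interaction-nonneg _ _) m

        Z≈ : Z f (doubleStar m) ≈ 2# * (A ^ m + C ^ m)
        Z≈ = begin-equality
          Z f (doubleStar m)
            ≈⟨ Z-doubleStar m ⟩
          (A ^ m + C ^ m) + (interaction true false ^ m + interaction true true ^ m)
            ≈⟨ +-congˡ (+-cong (^-congˡ m (interaction-comm true false)) (^-congˡ m (sym A≈B))) ⟩
          (A ^ m + C ^ m) + (C ^ m + A ^ m)
            ≈⟨ +-congˡ (+-comm _ _) ⟩
          (A ^ m + C ^ m) + (A ^ m + C ^ m)
            ≈⟨ x+x≈2x _ ⟩
          2# * (A ^ m + C ^ m) ∎

        Z>0 : 0# < Z f (doubleStar m)
        Z>0 = begin-strict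
          0#                   <⟨ *-pos 0<2 (^-pos 0<A m) ⟩
          2# * A ^ m           ≤⟨ *-monoʳ-≤ (inj₁ 0<2) (x≤x+y 0≤C^m) ⟩
          2# * (A ^ m + C ^ m) ≈⟨ Z≈ ⟨
          Z f (doubleStar m)   ∎

        A^m≈ : ∀ s → A ^ m ≈ interaction s s ^ m
        A^m≈ false = refl
        A^m≈ true  = ^-congˡ m A≈B

        -- As the two diagonal entries agree, Z is twice `A ^ m + C ^ m`; this 2 cancels the one in
        -- the required probability, and the rest is an estimate on `C ^ m` against `A ^ m`.
        bound : ∀ s → (1# - ε) / 2# [ 0<2 ] * Z f (doubleStar m) ≤ interaction s s ^ m
        bound s = begin
          (1# - ε) * recip 0<2 * Z f (doubleStar m)     ≈⟨ *-congˡ Z≈ ⟩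
          (1# - ε) * recip 0<2 * (2# * (A ^ m + C ^ m)) ≈⟨ *-assoc _ 2# _ ⟨
          (1# - ε) * recip 0<2 * 2# * (A ^ m + C ^ m)   ≈⟨ *-congʳ (*recip*z 0<2 (1# - ε)) ⟩
          (1# - ε) * (A ^ m + C ^ m)
            ≤⟨ ε-small⇒ 0≤C^m 0<ε (≤-trans (x≤x+y 0≤C^m) dominates) ⟩
          A ^ m                                         ≈⟨ A^m≈ s ⟩
          interaction s s ^ m                           ∎

    -- The inequality of arithmetic and geometric means is summed over all `x`. Equality throughout
    -- would make `f` independent of its first argument, hence constant by symmetry.
    cross-term-small : Symmetric f → ¬ Constant f →
      interaction false true + interaction false true < interaction false false + interaction true true
    cross-term-small symmetric nonconstant
      with sum-dichotomy j (λ x → am-gm (f (false ∷ x)) (f (true ∷ x)))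
    ... | inj₁ (head-inv , _) =
      ⊥-elim (nonconstant (SymmetricFunctions.head-invariant⇒constant ℝ f symmetric head-inv))
    ... | inj₂ lt = begin-strict
      interaction false true + interaction false true  ≈⟨ sum-+ j _ _ ⟨
      _                                                <⟨ lt ⟩
      _                                                ≈⟨ sum-+ j _ _ ⟩
      interaction false false + interaction true true  ∎

    supports : Symmetric f → ¬ Constant f →
      SupportsPinning f false ⊎ SupportsPinning f true ⊎ SupportsEquality f 2
    supports symmetric nonconstant
      with Order.compare (interaction false false) (interaction true true)
    ... | tri< A<B _ _ = inj₂ (inj₁ (pinning true A<B
      (Order.<-respˡ-≈ (interaction-comm false true)
        (double<sum⇒<max (inj₁ A<B) (cross-term-small symmetric nonconstant)))))
    -- In a tie either diagonal entry can serve as the larger one; commuting the sum makes it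
    -- `interaction false false`, the one that `equality` compares with.
    ... | tri≈ _ A≈B _ = inj₂ (inj₂ (equality A≈B
      (double<sum⇒<max (inj₂ (sym A≈B))
        (Order.<-respʳ-≈ (+-comm _ _) (cross-term-small symmetric nonconstant)))))
    ... | tri> _ _ B<A = inj₁ (pinning false B<A
      (double<sum⇒<max (inj₁ B<A)
        (Order.<-respʳ-≈ (+-comm _ _) (cross-term-small symmetric nonconstant))))

lemma13 : (ℝ : Reals) → let open Spin ℝ in
    (k : ℕ) → 2 ≤ℕ k →
    (f : Vec Bool k → Reals.Carrier ℝ) →
    NonNegative f → Symmetric f → ¬ Constant f →
    SupportsPinning f false ⊎ SupportsPinning f true ⊎ SupportsEquality f 2
lemma13 ℝ (suc j) (s≤s 0<j) f nonneg symmetric nonconstant =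
  DoubleStar.supports ℝ j 0<j f nonneg symmetric nonconstant
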